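{- For every $\varepsilon > 0$ there is a constant $K_\varepsilon>0$ such that every finite abelian group $G$ satisfies $T(G) \leq K_\varepsilon |G|^{3/4+\varepsilon}$. In particular, $T(n) = O(n^{3/4+\varepsilon})$ as $n \to \infty$.
   Context: For subsets $A,B$ of an abelian group $G$, $A+B=\{a+b\}$. A subset $C \subseteq G$ is a minimal complement in $G$ if there exists $W \subseteq G$ with $W + C = G$ and $W + C' \neq G$ for every proper subset $C' \subsetneq C$. For a finite abelian group $G$, $T(G)$ denotes the greatest integer $T$ with $0\le T\le|G|$ such that every non-empty subset $C \subseteq G$ with $|C| \leq T$ is a minimal complement in $G$; $T(n)$ is the minimum of $T(G)$ over all abelian groups $G$ of order $n$. -}

module Defs where

open import Data.Nat using (ℕ; _≤_)
open import Data.Fin using (Fin)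
open import Data.Fin.Subset using (Subset; _∈_; _⊂_; ∣_∣; Nonempty)
open import Data.Product using (Σ; ∃; _×_)
open import Relation.Nullary using (¬_)
open import Relation.Binary.PropositionalEquality using (_≡_)
open import Algebra.Structures using (IsAbelianGroup)

-- A finite abelian group of order n, presented on the carrier Fin n
-- (every finite abelian group of order n is isomorphic to one of these).
record FinAbGroup (n : ℕ) : Set where
  field
    _+_ : Fin n → Fin n → Fin n
    0# : Fin n
    -_ : Fin n → Fin n
    isAbelianGroup : IsAbelianGroup _≡_ _+_ 0# -_

module _ {n : ℕ} (G : FinAbGroup n) where
  open FinAbGroup G

  Covers : Subset n → Subset n → Set
  Covers W C = ∀ (g : Fin n) → ∃ λ w → ∃ λ c → w ∈ W × c ∈ C × (w + c) ≡ g

  MinimalComplement : Subset n → Set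
  MinimalComplement C =
    ∃ λ W → Covers W C × (∀ (C' : Subset n) → C' ⊂ C → ¬ Covers W C')

  GoodT : ℕ → Set
  GoodT T = T ≤ n × (∀ (C : Subset n) → Nonempty C → ∣ C ∣ ≤ T → MinimalComplement C)

  IsT : ℕ → Set
  IsT t = GoodT t × (∀ T → GoodT T → T ≤ t)

-- Let W be a set to which C is a minimal complement: each c ∈ C has some γ(c) ∈ W + C whose only
-- representation is through c. For a subgroup H and x with i x ∉ H for 0 < i ≤ j, take the
-- progression B = { h + i x : h ∈ H, i ≤ j } and C = B ∖ X with X = { 0, D x, 2 D x, … }.
-- Among the γ(c) in a block b + B, all w ∈ W with γ(c) ∈ w + B are already seen by the γ(c) of
-- lowest or of highest level, and each of these sees at most 1 + |X| elements of W.
-- If γ(c) ∈ w + X for some w ∈ W, this leaves at most 2 (1 + |X|) |X| values for γ(c).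
-- Otherwise γ(c) sees only w = γ(c) - c, there are at most two such w, and for each of them
-- the levels of γ(c) over w lie strictly between two consecutive multiples of D, since
-- otherwise some w + k D x would not lie in W + C. Averaging over b gives
--   |C| |B| ≤ 2 |G| (|H| (D - 1) + (1 + |X|) |X|).
-- With |G| ≤ r⁴ this fails for H = B of size more than 2 r² (C = H ∖ {0}), and it fails for
-- |H| ≤ 2 r², |B| ≈ 6 r³ and |H| D ≈ 4 r². Growing H by one generator at a time always meets one
-- of these two cases, so even T(G) ≤ 64 |G|^(3/4).

module Submission where

open import Defs
open import Algebra.Bundles using (AbelianGroup)
open import Data.Empty using (⊥; ⊥-elim)
open import Data.Fin using (Fin)
import Data.Fin.Properties as Fin
open import Data.Fin.Subset using (Subset; inside; outside; Nonempty; ⁅_⁆; ⋃; ∣_∣; _∪_; _⊂_)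
  renaming (_∈_ to _∈ₛ_)
import Data.Fin.Subset.Properties as Sub
open import Data.List using (List; []; _∷_; _++_; map; length; filter; upTo; allFin;
  concatMap; cartesianProduct; cartesianProductWith)
import Data.List.Properties as List
open import Data.List.Extrema.Nat using (argmin; argmax; argmin-sel; argmax-sel;
  f[argmin]≤f[⊤]; f[argmin]≤f[xs]; f[⊥]≤f[argmax]; f[xs]≤f[argmax])
import Data.List.Membership.DecPropositional as DecMembership
open import Data.List.Membership.Propositional using (_∈_; _∉_; find; lose)
open import Data.List.Membership.Propositional.Properties
open import Data.List.Relation.Binary.Subset.Propositional using (_⊆_)
import Data.List.Relation.Unary.All as All
import Data.List.Relation.Unary.All.Properties as All
open import Data.List.Relation.Unary.AllPairs using ([]; _∷_)
open import Data.List.Relation.Unary.Any as Any using (Any; here; there)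
open import Data.List.Relation.Unary.Unique.Propositional using (Unique)
import Data.List.Relation.Unary.Unique.Propositional.Properties as Unique
open import Data.Nat using (ℕ; zero; suc; pred; _≤_; _<_; _≤?_; _<?_; _*_; _+_; _∸_; _^_;
  _/_; _%_; NonZero; ≢-nonZero; >-nonZero; z≤n; s≤s)
open import Data.Nat.DivMod using (m≡m%n+[m/n]*n; m%n<n; m*n/n≡m; m/n*n≤m; /-monoˡ-≤)
open import Data.Nat.Properties
open import Data.Nat.Tactic.RingSolver using (solve-∀)
open import Data.Product using (Σ; ∃; _×_; _,_; proj₁; proj₂)
open import Data.Sum using (_⊎_; inj₁; inj₂; [_,_]′)
open import Data.Vec using ([]; _∷_)
open import Function using (_∘_; id)
open import Relation.Binary.PropositionalEquality
open import Relation.Nullary using (¬_; Dec; yes; no; ¬?; contradiction)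
open import Relation.Unary using (Decidable)

-- Counting in lists without repetition.

module _ {A : Set} where

  -- Pigeonhole: one occurrence of the head is deleted from `ys`; the head does not recur in the
  -- tail, so the tail stays inside what is left.
  length-mono-⊆ : ∀ {xs ys : List A} → Unique xs → xs ⊆ ys → length xs ≤ length ys
  length-mono-⊆ {[]}     _            _   = z≤n
  length-mono-⊆ {x ∷ xs} (x∉xs ∷ uxs) sub
    with ys , zs , refl ← ∈-∃++ (sub (here refl)) =
    subst (suc (length xs) ≤_) (sym eq) (s≤s (length-mono-⊆ uxs sub′))
    where
    eq : length (ys ++ x ∷ zs) ≡ suc (length (ys ++ zs))
    eq = trans (List.length-++ ys) (trans (+-suc (length ys) (length zs))
           (cong suc (sym (List.length-++ ys))))
    sub′ : xs ⊆ ys ++ zs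
    sub′ {y} y∈xs with ∈-++⁻ ys (sub (there y∈xs))
    ... | inj₁ y∈ys          = ∈-++⁺ˡ y∈ys
    ... | inj₂ (here y≡x)    = contradiction (sym y≡x) (All.lookup x∉xs y∈xs)
    ... | inj₂ (there y∈zs)  = ∈-++⁺ʳ ys y∈zs

module _ {A B : Set} (f : A → B) where

  unique-map : ∀ {xs} → (∀ {x y} → x ∈ xs → y ∈ xs → f x ≡ f y → x ≡ y) →
               Unique xs → Unique (map f xs)
  unique-map {[]}     _   _            = []
  unique-map {x ∷ xs} inj (x∉xs ∷ uxs) =
    All.map⁺ (All.tabulate λ y∈xs fx≡fy →
      All.lookup x∉xs y∈xs (inj (here refl) (there y∈xs) fx≡fy))
    ∷ unique-map (λ p q → inj (there p) (there q)) uxs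

module _ {A B : Set} where

  length-concatMap-≤ : ∀ (f : A → List B) {k} → (∀ x → length (f x) ≤ k) →
                       ∀ xs → length (concatMap f xs) ≤ length xs * k
  length-concatMap-≤ f bd []       = z≤n
  length-concatMap-≤ f bd (x ∷ xs) =
    subst (_≤ _) (sym (List.length-++ (f x))) (+-mono-≤ (bd x) (length-concatMap-≤ f bd xs))

length-cartesianProductWith : ∀ {A B C : Set} (f : A → B → C) xs ys →
  length (cartesianProductWith f xs ys) ≡ length xs * length ys
length-cartesianProductWith f []       ys = refl
length-cartesianProductWith f (x ∷ xs) ys =
  trans (List.length-++ (map (f x) ys))
    (cong₂ _+_ (List.length-map (f x) ys) (length-cartesianProductWith f xs ys))

argmin-∈ : ∀ {A : Set} (f : A → ℕ) x xs → argmin f x xs ∈ x ∷ xs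
argmin-∈ f x xs = [ here , there ]′ (argmin-sel f x xs)

argmax-∈ : ∀ {A : Set} (f : A → ℕ) x xs → argmax f x xs ∈ x ∷ xs
argmax-∈ f x xs = [ here , there ]′ (argmax-sel f x xs)

argmin-≤ : ∀ {A : Set} (f : A → ℕ) x xs {y} → y ∈ x ∷ xs → f (argmin f x xs) ≤ f y
argmin-≤ f x xs (here refl) = f[argmin]≤f[⊤] {f = f} x xs
argmin-≤ f x xs (there y∈xs) = All.lookup (f[argmin]≤f[xs] {f = f} x xs) y∈xs

argmax-≥ : ∀ {A : Set} (f : A → ℕ) x xs {y} → y ∈ x ∷ xs → f y ≤ f (argmax f x xs)
argmax-≥ f x xs (here refl) = f[⊥]≤f[argmax] {f = f} x xs
argmax-≥ f x xs (there y∈xs) = All.lookup (f[xs]≤f[argmax] {f = f} x xs) y∈xs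

∣p∪q∣≤∣p∣+∣q∣ : ∀ {n} (p q : Subset n) → ∣ p ∪ q ∣ ≤ ∣ p ∣ + ∣ q ∣
∣p∪q∣≤∣p∣+∣q∣ []            []            = z≤n
∣p∪q∣≤∣p∣+∣q∣ (outside ∷ p) (outside ∷ q) = ∣p∪q∣≤∣p∣+∣q∣ p q
∣p∪q∣≤∣p∣+∣q∣ (outside ∷ p) (inside ∷ q)  =
  subst (suc ∣ p ∪ q ∣ ≤_) (sym (+-suc ∣ p ∣ ∣ q ∣)) (s≤s (∣p∪q∣≤∣p∣+∣q∣ p q))
∣p∪q∣≤∣p∣+∣q∣ (inside ∷ p)  (s ∷ q)       =
  s≤s (≤-trans (∣p∪q∣≤∣p∣+∣q∣ p q) (+-monoʳ-≤ ∣ p ∣ (Sub.∣p∣≤∣x∷p∣ s q)))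

m/n<o⇒m<o*n : ∀ m n .{{_ : NonZero n}} {o} → m / n < o → m < o * n
m/n<o⇒m<o*n m n {o} m/n<o with m <? o * n
... | yes p = p
... | no ¬p = contradiction (subst (_≤ m / n) (m*n/n≡m o n) (/-monoˡ-≤ n (≮⇒≥ ¬p)))
                (<⇒≱ m/n<o)

-- Subsets of a finite set given by lists.

module _ {n : ℕ} where

  open DecMembership (Fin._≟_ {n}) using (_∈?_)

  fromList : List (Fin n) → Subset n
  fromList = ⋃ ∘ map ⁅_⁆

  ∈-fromList⁺ : ∀ {x xs} → x ∈ xs → x ∈ₛ fromList xs
  ∈-fromList⁺ (here refl) = Sub.x∈p∪q⁺ (inj₁ (Sub.x∈⁅x⁆ _))
  ∈-fromList⁺ (there x∈xs) = Sub.x∈p∪q⁺ (inj₂ (∈-fromList⁺ x∈xs))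

  ∈-fromList⁻ : ∀ {x} xs → x ∈ₛ fromList xs → x ∈ xs
  ∈-fromList⁻ []       x∈ = contradiction x∈ Sub.∉⊥
  ∈-fromList⁻ (y ∷ xs) x∈ with Sub.x∈p∪q⁻ ⁅ y ⁆ (fromList xs) x∈
  ... | inj₁ x∈y  = here (Sub.x∈⁅y⁆⇒x≡y y x∈y)
  ... | inj₂ x∈xs = there (∈-fromList⁻ xs x∈xs)

  ∣fromList∣≤length : ∀ xs → ∣ fromList xs ∣ ≤ length xs
  ∣fromList∣≤length []       = ≤-reflexive (Sub.∣⊥∣≡0 n)
  ∣fromList∣≤length (x ∷ xs) = ≤-trans (∣p∪q∣≤∣p∣+∣q∣ ⁅ x ⁆ (fromList xs))
    (+-mono-≤ (≤-reflexive (Sub.∣⁅x⁆∣≡1 x)) (∣fromList∣≤length xs))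

  -- Decidable membership makes the witnesses into a total function; off `xs` its value is the
  -- arbitrary `default`.
  choice : ∀ {P : Fin n → Fin n → Set} (xs : List (Fin n)) → Fin n →
           (∀ {x} → x ∈ xs → ∃ (P x)) → ∃ λ f → ∀ {x} → x ∈ xs → P x (f x)
  choice {P} xs default p = f , f-spec
    where
    f : Fin n → Fin n
    f x with x ∈? xs
    ... | yes x∈xs = proj₁ (p x∈xs)
    ... | no  _    = default
    f-spec : ∀ {x} → x ∈ xs → P x (f x)
    f-spec {x} x∈xs with x ∈? xs
    ... | yes x∈xs′ = proj₂ (p x∈xs′)
    ... | no  x∉xs  = contradiction x∈xs x∉xs

-- Finite abelian groups and their subgroups.

module GroupLemmas {n : ℕ} (G : FinAbGroup n) where

  open FinAbGroup G public using () renaming (_+_ to infixl 6 _⊕_; 0# to 𝟘; -_ to ⊝_)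

  𝔾 : AbelianGroup _ _
  𝔾 = record { isAbelianGroup = FinAbGroup.isAbelianGroup G }

  open AbelianGroup 𝔾 public using ()
    renaming (comm to ⊕-comm; assoc to ⊕-assoc; identityˡ to ⊕-identityˡ;
      identityʳ to ⊕-identityʳ; inverseʳ to ⊝-inverseʳ)

  infixl 6 _⊖_
  _⊖_ : Fin n → Fin n → Fin n
  a ⊖ b = a ⊕ ⊝ b

  open import Algebra.Properties.AbelianGroup 𝔾 public
    using (∙-cancelˡ; ∙-cancelʳ; //-rightDividesˡ; //-rightDividesʳ)
  open import Algebra.Properties.Monoid.Mult (AbelianGroup.monoid 𝔾) public
    using (×-homo-+) renaming (_×_ to infixr 7 _·_)
  open import Algebra.Solver.CommutativeMonoid (AbelianGroup.commutativeMonoid 𝔾) public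
    using (solve; _⊜_) renaming (_⊕_ to _:+_)

  ⊖-⊕ : ∀ a b → b ⊕ (a ⊖ b) ≡ a
  ⊖-⊕ a b = trans (⊕-comm b (a ⊖ b)) (//-rightDividesˡ b a)

  ⊕-⊖ : ∀ a b → (a ⊕ b) ⊖ a ≡ b
  ⊕-⊖ a b = trans (cong (_⊖ a) (⊕-comm a b)) (//-rightDividesʳ a b)

  ⊖-⊖ : ∀ a b → a ⊖ (a ⊖ b) ≡ b
  ⊖-⊖ a b = ∙-cancelˡ (a ⊖ b) _ _ (trans (⊖-⊕ a (a ⊖ b)) (sym (//-rightDividesˡ b a)))

  ⊖-injectiveʳ : ∀ a {b c} → a ⊖ b ≡ a ⊖ c → b ≡ c
  ⊖-injectiveʳ a {b} {c} eq =
    trans (sym (⊖-⊖ a b)) (trans (cong (a ⊖_) eq) (⊖-⊖ a c))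

  ⊕⇒⊖ : ∀ {a b g} → b ⊕ a ≡ g → g ⊖ a ≡ b
  ⊕⇒⊖ {a} {b} refl = //-rightDividesʳ a b

  -- The list has no repetitions, so its length is the order of the subgroup.
  record Subgroup : Set where
    field
      elements : List (Fin n)
      unique   : Unique elements
      𝟘∈       : 𝟘 ∈ elements
      ⊕-closed : ∀ {a b} → a ∈ elements → b ∈ elements → a ⊕ b ∈ elements
      ⊝-closed : ∀ {a} → a ∈ elements → ⊝ a ∈ elements

    ⊖-closed : ∀ {a b} → a ∈ elements → b ∈ elements → a ⊖ b ∈ elements
    ⊖-closed a∈ b∈ = ⊕-closed a∈ (⊝-closed b∈)

  -- Counting steps of `x` modulo a subgroup.

  module Levels (S : Subgroup) (x : Fin n) where

    open Subgroup S

    -- g lies i steps of x above w modulo the subgroup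
    record Sees (g w : Fin n) (i : ℕ) : Set where
      constructor sees
      field
        h  : Fin n
        h∈ : h ∈ elements
        eq : g ≡ w ⊕ (h ⊕ i · x)

    -- Measured from b, l lies δ steps below g modulo the subgroup, so of the δ + ε steps from w to
    -- g exactly ε remain. Subtraction is replaced by cancelling `h ⊕ δ · x`.
    sees-lower : ∀ {b w g l i δ ε} → Sees l b i → Sees g b (i + δ) → Sees g w (δ + ε) →
                 Sees l w ε
    sees-lower {b} {w} {g} {l} {i} {δ} {ε} (sees hl hl∈ refl) (sees h h∈ refl) (sees h′ h′∈ eq) =
      sees ((h′ ⊖ h) ⊕ hl) (⊕-closed (⊖-closed h′∈ h∈) hl∈) (∙-cancelʳ (h ⊕ δ · x) _ _ (begin
        b ⊕ (hl ⊕ i · x) ⊕ (h ⊕ δ · x)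
          ≡⟨ solve 5 (λ b hl i h δ → (b :+ (hl :+ i)) :+ (h :+ δ) ⊜ (b :+ (h :+ (i :+ δ))) :+ hl)
               refl b hl (i · x) h (δ · x) ⟩
        b ⊕ (h ⊕ (i · x ⊕ δ · x)) ⊕ hl
          ≡⟨ cong (λ z → b ⊕ (h ⊕ z) ⊕ hl) (sym (×-homo-+ x i δ)) ⟩
        b ⊕ (h ⊕ (i + δ) · x) ⊕ hl
          ≡⟨ cong (_⊕ hl) eq ⟩
        w ⊕ (h′ ⊕ (δ + ε) · x) ⊕ hl
          ≡⟨ cong₂ (λ y z → w ⊕ (y ⊕ z) ⊕ hl) (sym (//-rightDividesˡ h h′)) (×-homo-+ x δ ε) ⟩
        w ⊕ ((h′ ⊖ h ⊕ h) ⊕ (δ · x ⊕ ε · x)) ⊕ hl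
          ≡⟨ solve 6 (λ w k h δ ε hl → (w :+ ((k :+ h) :+ (δ :+ ε))) :+ hl ⊜
               (w :+ ((k :+ hl) :+ ε)) :+ (h :+ δ))
               refl w (h′ ⊖ h) h (δ · x) (ε · x) hl ⟩
        w ⊕ ((h′ ⊖ h) ⊕ hl ⊕ ε · x) ⊕ (h ⊕ δ · x) ∎))
      where open ≡-Reasoning

    -- The mirror image: u lies δ steps above g.
    sees-upper : ∀ {b w g u i δ ε} → Sees g b i → Sees u b (i + δ) → Sees g w ε →
                 Sees u w (ε + δ)
    sees-upper {b} {w} {g} {u} {i} {δ} {ε} (sees h h∈ refl) (sees hu hu∈ refl) (sees h′ h′∈ eq) =
      sees ((h′ ⊖ h) ⊕ hu) (⊕-closed (⊖-closed h′∈ h∈) hu∈) (∙-cancelʳ h _ _ (begin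
        b ⊕ (hu ⊕ (i + δ) · x) ⊕ h
          ≡⟨ cong (λ z → b ⊕ (hu ⊕ z) ⊕ h) (×-homo-+ x i δ) ⟩
        b ⊕ (hu ⊕ (i · x ⊕ δ · x)) ⊕ h
          ≡⟨ solve 5 (λ b hu i δ h → (b :+ (hu :+ (i :+ δ))) :+ h ⊜ (b :+ (h :+ i)) :+ (hu :+ δ))
               refl b hu (i · x) (δ · x) h ⟩
        b ⊕ (h ⊕ i · x) ⊕ (hu ⊕ δ · x)
          ≡⟨ cong (_⊕ (hu ⊕ δ · x)) eq ⟩
        w ⊕ (h′ ⊕ ε · x) ⊕ (hu ⊕ δ · x)
          ≡⟨ cong (λ y → w ⊕ (y ⊕ ε · x) ⊕ (hu ⊕ δ · x)) (sym (//-rightDividesˡ h h′)) ⟩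
        w ⊕ ((h′ ⊖ h ⊕ h) ⊕ ε · x) ⊕ (hu ⊕ δ · x)
          ≡⟨ solve 6 (λ w k h ε hu δ → (w :+ ((k :+ h) :+ ε)) :+ (hu :+ δ) ⊜
               (w :+ ((k :+ hu) :+ (ε :+ δ))) :+ h)
               refl w (h′ ⊖ h) h (ε · x) hu (δ · x) ⟩
        w ⊕ ((h′ ⊖ h) ⊕ hu ⊕ (ε · x ⊕ δ · x)) ⊕ h
          ≡⟨ cong (λ z → w ⊕ ((h′ ⊖ h) ⊕ hu ⊕ z) ⊕ h) (sym (×-homo-+ x ε δ)) ⟩
        w ⊕ ((h′ ⊖ h) ⊕ hu ⊕ (ε + δ) · x) ⊕ h ∎))
      where open ≡-Reasoning

    SeesWithin : ℕ → Fin n → Fin n → Set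
    SeesWithin j g w = ∃ λ i → i ≤ j × Sees g w i

    -- Let w lie i′ steps below g. If `i ∸ il` is at most i′, going down to l does not pass w.
    -- Otherwise i′ < i, so w starts above b, and u is fewer than iu ≤ j steps above w or as many.
    sees-extreme : ∀ {j b w l g u il i iu} → il ≤ i → i ≤ iu → iu ≤ j →
                   Sees l b il → Sees g b i → Sees u b iu → SeesWithin j g w →
                   SeesWithin j l w ⊎ SeesWithin j u w
    sees-extreme {j} {il = il} {i} {iu} il≤i i≤iu iu≤j sl sg su (i′ , i′≤j , sw)
      with i ∸ il ≤? i′
    ... | yes p = inj₁ (i′ ∸ (i ∸ il) , ≤-trans (m∸n≤m i′ (i ∸ il)) i′≤j ,
            sees-lower sl (subst (Sees _ _) (sym (m+[n∸m]≡n il≤i)) sg)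
              (subst (Sees _ _) (sym (m+[n∸m]≡n p)) sw))
    ... | no ¬p = inj₂ (i′ + (iu ∸ i) , bound ,
            sees-upper sg (subst (Sees _ _) (sym (m+[n∸m]≡n i≤iu)) su) sw)
      where
      open ≤-Reasoning
      bound : i′ + (iu ∸ i) ≤ j
      bound = begin
        i′ + (iu ∸ i)     ≤⟨ +-monoˡ-≤ (iu ∸ i) (<⇒≤ (≰⇒> ¬p)) ⟩
        i ∸ il + (iu ∸ i) ≤⟨ +-monoˡ-≤ (iu ∸ i) (m∸n≤m i il) ⟩
        i + (iu ∸ i)      ≡⟨ m+[n∸m]≡n i≤iu ⟩
        iu                ≤⟨ iu≤j ⟩
        j ∎

-- The progression B, its holes X and the set C.

-- B has the suc j levels 0, …, j, and the holes X are suc d levels apart (D = suc d above).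
module Progression {n : ℕ} (G : FinAbGroup n) (S : GroupLemmas.Subgroup G) (x : Fin n)
  (j d : ℕ) where

  open GroupLemmas G
  open Subgroup S
  open Levels S x
  open DecMembership (Fin._≟_ {n}) using (_∈?_)
  open import Algebra.Properties.AbelianGroup 𝔾 using (inverseʳ-unique)

  -- This is the order of the subgroup H, not its index in the group.
  index : ℕ
  index = length elements

  -- The number of multiples of `suc d` among the levels 0, ..., j.
  holes : ℕ
  holes = suc (j / suc d)

  at : Fin n × ℕ → Fin n
  at (h , i) = h ⊕ i · x

  indices : List (Fin n × ℕ)
  indices = cartesianProduct elements (upTo (suc j))

  Bs Xs Cs : List (Fin n)
  Bs = map at indices
  Xs = map (λ k → (k * suc d) · x) (upTo holes)
  Cs = filter (¬? ∘ (_∈? Xs)) Bs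

  length-Bs : length Bs ≡ index * suc j
  length-Bs = trans (List.length-map at indices)
    (trans (length-cartesianProductWith _,_ elements (upTo (suc j)))
      (cong (index *_) (List.length-upTo (suc j))))

  length-Xs : length Xs ≡ holes
  length-Xs = trans (List.length-map _ (upTo holes)) (List.length-upTo holes)

  length-Cs-≤ : length Cs ≤ index * suc j
  length-Cs-≤ = subst (length Cs ≤_) length-Bs (List.length-filter (¬? ∘ (_∈? Xs)) Bs)

  C⊆B : Cs ⊆ Bs
  C⊆B c∈ = proj₁ (∈-filter⁻ (¬? ∘ (_∈? Xs)) {xs = Bs} c∈)

  C∩X : ∀ {a} → a ∈ Cs → a ∉ Xs
  C∩X c∈ = proj₂ (∈-filter⁻ (¬? ∘ (_∈? Xs)) {xs = Bs} c∈)

  B⊆X∪C : ∀ {a} → a ∈ Bs → a ∈ Xs ⊎ a ∈ Cs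
  B⊆X∪C {a} a∈B with a ∈? Xs
  ... | yes a∈X = inj₁ a∈X
  ... | no  a∉X = inj₂ (∈-filter⁺ (¬? ∘ (_∈? Xs)) a∈B a∉X)

  at∈B : ∀ {h i} → h ∈ elements → i ≤ j → h ⊕ i · x ∈ Bs
  at∈B h∈ i≤j = ∈-map⁺ at (∈-cartesianProduct⁺ h∈ (∈-upTo⁺ (s≤s i≤j)))

  ∈B⇒at : ∀ {a} → a ∈ Bs → ∃ λ h → ∃ λ i → h ∈ elements × i ≤ j × a ≡ h ⊕ i · x
  ∈B⇒at a∈ with ∈-map⁻ at a∈
  ... | (h , i) , p , eq with ∈-cartesianProduct⁻ elements (upTo (suc j)) p
  ... | h∈ , i∈ = h , i , h∈ , ≤-pred (∈-upTo⁻ i∈) , eq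

  ∈B⇒sees : ∀ {a} → a ∈ Bs → SeesWithin j a 𝟘
  ∈B⇒sees a∈B with ∈B⇒at a∈B
  ... | h , i , h∈ , i≤j , refl = i , i≤j , sees h h∈ (sym (⊕-identityˡ _))

  sees⇒∈B : ∀ {g w i} → i ≤ j → Sees g w i → g ⊖ w ∈ Bs
  sees⇒∈B {w = w} {i} i≤j (sees h h∈ refl) =
    subst (_∈ Bs) (sym (⊕-⊖ w (h ⊕ i · x))) (at∈B h∈ i≤j)

  hole∈X : ∀ {k} → k * suc d ≤ j → (k * suc d) · x ∈ Xs
  hole∈X {k} kd≤j = ∈-map⁺ _ (∈-upTo⁺ {n = holes} (s≤s
    (subst (_≤ j / suc d) (m*n/n≡m k (suc d)) (/-monoˡ-≤ (suc d) kd≤j))))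

  X⊆B : ∀ {ξ} → ξ ∈ Xs → SeesWithin j ξ 𝟘
  X⊆B ξ∈ with ∈-map⁻ _ ξ∈
  ... | k , k∈ , refl = k * suc d ,
        ≤-trans (*-monoˡ-≤ (suc d) (≤-pred (∈-upTo⁻ k∈))) (m/n*n≤m j (suc d)) ,
        sees 𝟘 𝟘∈ (sym (trans (⊕-identityˡ _) (⊕-identityˡ _)))

  -- An element of B may lie on several levels when multiples of x fall into H; one level is fixed
  -- here. The value 0 off B is a default.
  level : Fin n → ℕ
  level a with a ∈? Bs
  ... | yes a∈B = proj₁ (∈B⇒sees a∈B)
  ... | no  _   = 0

  level-≤ : ∀ a → level a ≤ j
  level-≤ a with a ∈? Bs
  ... | yes a∈B = proj₁ (proj₂ (∈B⇒sees a∈B))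
  ... | no  _   = z≤n

  sees-level : ∀ {a} → a ∈ Bs → Sees a 𝟘 (level a)
  sees-level {a} a∈B with a ∈? Bs
  ... | yes a∈B′ = proj₂ (proj₂ (∈B⇒sees a∈B′))
  ... | no  a∉B  = contradiction a∈B a∉B

  sees-shift : ∀ {a g w i} → w ⊕ a ≡ g → Sees a 𝟘 i → Sees g w i
  sees-shift {w = w} refl (sees h h∈ refl) = sees h h∈ (cong (w ⊕_) (⊕-identityˡ _))

  sees-⊖ : ∀ {g b} → g ⊖ b ∈ Bs → Sees g b (level (g ⊖ b))
  sees-⊖ {g} {b} p = sees-shift (⊖-⊕ g b) (sees-level p)

  -- What the values of γ can see in W.

  -- W ⊕ C is everything, and γ c is represented in W ⊕ C through c only.
  module Counting (W : Fin n → Set) (W? : Decidable W) (γ : Fin n → Fin n)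
    (covers : ∀ g → ∃ λ a → a ∈ Cs × W (g ⊖ a))
    (only : ∀ {c a} → c ∈ Cs → a ∈ Cs → W (γ c ⊖ a) → a ≡ c) where

    hit : ∀ {c} → c ∈ Cs → W (γ c ⊖ c)
    hit {c} c∈ with covers (γ c)
    ... | a , a∈ , wa = subst (λ z → W (γ c ⊖ z)) (only c∈ a∈ wa) wa

    -- The common value is represented through c, but the choice of γ at c′ allows only c′.
    γ-injective : ∀ {c c′} → c ∈ Cs → c′ ∈ Cs → γ c ≡ γ c′ → c ≡ c′
    γ-injective {c} c∈ c′∈ eq = only c′∈ c∈ (subst (λ z → W (z ⊖ c)) eq (hit c∈))

    HitsHole : Fin n → Set
    HitsHole c = Any (λ ξ → W (γ c ⊖ ξ)) Xs

    HitsHole? : Decidable HitsHole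
    HitsHole? c = Any.any? (λ ξ → W? (γ c ⊖ ξ)) Xs

    -- The difference `γ c ⊖ w` lies in B. In X, it is itself the hole that is hit; in C, it
    -- represents γ c and must be c.
    seen-cases : ∀ {c w} → c ∈ Cs → W w → SeesWithin j (γ c) w →
                 (γ c ⊖ w ∈ Xs × HitsHole c) ⊎ γ c ⊖ w ≡ c
    seen-cases {c} {w} c∈ ww (i , i≤j , s) with B⊆X∪C (sees⇒∈B i≤j s)
    ... | inj₁ ∈X = inj₁ (∈X , Any.map (λ { refl → subst W (sym (⊖-⊖ (γ c) w)) ww }) ∈X)
    ... | inj₂ ∈C = inj₂ (only c∈ ∈C (subst W (sym (⊖-⊖ (γ c) w)) ww))

    seen : Fin n → List (Fin n)
    seen c = map (γ c ⊖_) (c ∷ Xs)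

    ∈-seen : ∀ {c w} → c ∈ Cs → W w → SeesWithin j (γ c) w → w ∈ seen c
    ∈-seen {c} {w} c∈ ww s = subst (_∈ seen c) (⊖-⊖ (γ c) w) (∈-map⁺ (γ c ⊖_) mem)
      where
      mem : γ c ⊖ w ∈ c ∷ Xs
      mem with seen-cases c∈ ww s
      ... | inj₁ (∈X , _) = there ∈X
      ... | inj₂ eq       = here eq

    seen-alone : ∀ {c w} → c ∈ Cs → ¬ HitsHole c → W w → SeesWithin j (γ c) w → w ≡ γ c ⊖ c
    seen-alone {c} {w} c∈ ¬hole ww s with seen-cases c∈ ww s
    ... | inj₁ (_ , hole) = contradiction hole ¬hole
    ... | inj₂ eq         = trans (sym (⊖-⊖ (γ c) w)) (cong (γ c ⊖_) eq)

    sees-own : ∀ {c} → c ∈ Cs → Sees (γ c) (γ c ⊖ c) (level c)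
    sees-own {c} c∈ = sees-shift (//-rightDividesˡ c (γ c)) (sees-level (C⊆B c∈))

    -- Otherwise the translate putting the common element of W into that hole is not covered.
    no-hole-between : ∀ {c c′ k} → c ∈ Cs → c′ ∈ Cs → ¬ HitsHole c → ¬ HitsHole c′ →
      γ c ⊖ c ≡ γ c′ ⊖ c′ → level c ≤ k * suc d → ¬ k * suc d ≤ level c′
    no-hole-between {c} {c′} {k} c∈ c′∈ ¬hole ¬hole′ eq lo hi
      with covers ((γ c ⊖ c) ⊕ (k * suc d) · x)
    ... | a , a∈ , wa = C∩X a∈ (subst (_∈ Xs) (sym a≡ξ) ξ∈X)
      where
      w ξ g : Fin n
      w = γ c ⊖ c
      ξ = (k * suc d) · x
      g = w ⊕ ξ
      kd≤j : k * suc d ≤ j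
      kd≤j = ≤-trans hi (level-≤ c′)
      ξ∈X : ξ ∈ Xs
      ξ∈X = hole∈X {k} kd≤j
      sees-g : Sees g w (k * suc d)
      sees-g = sees 𝟘 𝟘∈ (cong (w ⊕_) (sym (⊕-identityˡ _)))
      g-a≡w : g ⊖ a ≡ w
      -- Based at w, g lies between γ c and γ c′, so one of these sees `g ⊖ a`. Neither hits a hole,
      -- and each therefore sees only w.
      g-a≡w with sees-extreme lo hi (level-≤ c′) (sees-own c∈) sees-g
        (subst (λ z → Sees (γ c′) z (level c′)) (sym eq) (sees-own c′∈))
        (level a , level-≤ a , sees-shift (//-rightDividesˡ a g) (sees-level (C⊆B a∈)))
      ... | inj₁ s = seen-alone c∈ ¬hole wa s
      ... | inj₂ s = trans (seen-alone c′∈ ¬hole′ wa s) (sym eq)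
      a≡ξ : a ≡ ξ
      a≡ξ = ⊖-injectiveʳ g (trans g-a≡w (sym (//-rightDividesʳ ξ w)))

    -- Candidates over `γ c ⊖ c` at the d levels strictly between two consecutive multiples of
    -- `suc d`: `suc ρ` runs through the nonzero residues.
    near : Fin n → List (Fin n)
    near c = cartesianProductWith
      (λ h ρ → (γ c ⊖ c) ⊕ (h ⊕ (level c / suc d * suc d + suc ρ) · x)) elements (upTo d)

    ∈-near : ∀ {c c′} → c ∈ Cs → c′ ∈ Cs → ¬ HitsHole c → ¬ HitsHole c′ →
      γ c ⊖ c ≡ γ c′ ⊖ c′ → γ c ∈ near c′
    ∈-near {c} {c′} c∈ c′∈ ¬hole ¬hole′ eq with sees-own c∈
    ... | sees h h∈ refl-eq = subst (_∈ near c′) (sym γc≡) (∈-cartesianProductWith⁺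
            (λ h ρ → (γ c′ ⊖ c′) ⊕ (h ⊕ (level c′ / suc d * suc d + suc ρ) · x)) h∈ (∈-upTo⁺ ρ<d))
      where
      D = suc d
      -- A larger quotient at a′ would place the multiple `level a′ / D * D` between the two levels.
      quot-≤ : ∀ {a a′} → a ∈ Cs → a′ ∈ Cs → ¬ HitsHole a → ¬ HitsHole a′ →
               γ a ⊖ a ≡ γ a′ ⊖ a′ → level a′ / D ≤ level a / D
      quot-≤ {a} {a′} a∈ a′∈ ¬ha ¬ha′ e with level a′ / D ≤? level a / D
      ... | yes p = p
      ... | no ¬p = contradiction (m/n*n≤m (level a′) D)
        (no-hole-between {k = level a′ / D} a∈ a′∈ ¬ha ¬ha′ e
          (<⇒≤ (m/n<o⇒m<o*n (level a) D (≰⇒> ¬p))))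
      quot : level c / D ≡ level c′ / D
      quot = ≤-antisym (quot-≤ c′∈ c∈ ¬hole′ ¬hole (sym eq)) (quot-≤ c∈ c′∈ ¬hole ¬hole′ eq)
      -- A level that is itself a multiple of D is excluded by `no-hole-between` with c on both
      -- sides.
      rem≢0 : level c % D ≢ 0
      rem≢0 r≡0 = no-hole-between {k = level c / D} c∈ c∈ ¬hole ¬hole refl
        (≤-reflexive lv) (≤-reflexive (sym lv))
        where
        lv : level c ≡ level c / D * D
        lv = trans (m≡m%n+[m/n]*n (level c) D) (cong (_+ level c / D * D) r≡0)
      ρ : ℕ
      ρ = pred (level c % D)
      sucρ : suc ρ ≡ level c % D
      sucρ = suc-pred (level c % D) {{≢-nonZero rem≢0}}
      ρ<d : ρ < d
      ρ<d = ≤-pred (subst (_< D) (sym sucρ) (m%n<n (level c) D))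
      level≡ : level c ≡ level c′ / D * D + suc ρ
      level≡ = begin
        level c                      ≡⟨ m≡m%n+[m/n]*n (level c) D ⟩
        level c % D + level c / D * D ≡⟨ +-comm (level c % D) _ ⟩
        level c / D * D + level c % D ≡⟨ cong₂ (λ y z → y * D + z) quot (sym sucρ) ⟩
        level c′ / D * D + suc ρ     ∎
        where open ≡-Reasoning
      γc≡ : γ c ≡ (γ c′ ⊖ c′) ⊕ (h ⊕ (level c′ / D * D + suc ρ) · x)
      γc≡ = trans refl-eq (cong₂ (λ y z → y ⊕ (h ⊕ z · x)) eq level≡)

    -- Counting the values of γ in one translate of B.

    module Block (b : Fin n) where

      height : Fin n → ℕ
      height c = level (γ c ⊖ b)

      InBlock : Fin n → Set
      InBlock c = c ∈ Cs × γ c ⊖ b ∈ Bs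

      seen-by-extremes : ∀ {l c u w} → InBlock l → InBlock c → InBlock u →
        height l ≤ height c → height c ≤ height u → SeesWithin j (γ c) w →
        SeesWithin j (γ l) w ⊎ SeesWithin j (γ u) w
      seen-by-extremes {u = u} (_ , l∈) (_ , c∈) (_ , u∈) lo hi =
        sees-extreme lo hi (level-≤ (γ u ⊖ b)) (sees-⊖ l∈) (sees-⊖ c∈) (sees-⊖ u∈)

      alone? : Decidable (λ c → ¬ HitsHole c)
      alone? = ¬? ∘ HitsHole?

      inBlock? : Decidable (λ c → γ c ⊖ b ∈ Bs)
      inBlock? c = (γ c ⊖ b) ∈? Bs

      members alone crowded : List (Fin n)
      members = filter inBlock? Cs
      alone   = filter alone? members
      crowded = filter HitsHole? members

      ∈-members : ∀ {c} → c ∈ members → InBlock c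
      ∈-members = ∈-filter⁻ inBlock? {xs = Cs}

      -- Extremes are taken separately in `alone` and in `crowded`: for the first kind the extreme
      -- must itself avoid the holes, so that it sees a single element of W. The head of the list
      -- starts the search for extremes.
      targets₁ targets₂ : List (Fin n) → List (Fin n)
      targets₁ []       = []
      targets₁ (c ∷ cs) = near (argmin height c cs) ++ near (argmax height c cs)
      targets₂ []       = []
      targets₂ (c ∷ cs) = cartesianProductWith _⊕_
        (seen (argmin height c cs) ++ seen (argmax height c cs)) Xs

      -- One of the extremes sees `γ c ⊖ c`. Seeing only one element of W, it shares that element
      -- with c, and `∈-near` applies.
      ∈-targets₁ : ∀ {c} cs → (∀ {a} → a ∈ cs → InBlock a × ¬ HitsHole a) → c ∈ cs →
                   γ c ∈ targets₁ cs
      ∈-targets₁ {c} (a ∷ as) all c∈ with all (argmin-∈ height a as) | all (argmax-∈ height a as) | all c∈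
      ... | l@(l∈ , _) , ¬hl | u@(u∈ , _) , ¬hu | c@(c∈C , _) , ¬hc
        with seen-by-extremes l c u (argmin-≤ height a as c∈) (argmax-≥ height a as c∈)
               (_ , level-≤ _ , sees-own c∈C)
      ... | inj₁ s = ∈-++⁺ˡ (∈-near c∈C l∈ ¬hc ¬hl (seen-alone l∈ ¬hl (hit c∈C) s))
      ... | inj₂ s = ∈-++⁺ʳ _ (∈-near c∈C u∈ ¬hc ¬hu (seen-alone u∈ ¬hu (hit c∈C) s))

      -- If ξ is the hole hit by γ c, then `γ c ⊖ ξ` is in W and seen by an extreme, and adding ξ
      -- back recovers γ c.
      ∈-targets₂ : ∀ {c} cs → (∀ {a} → a ∈ cs → InBlock a) → c ∈ cs → HitsHole c →
                   γ c ∈ targets₂ cs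
      ∈-targets₂ {c} (a ∷ as) all c∈ hole with find hole
      ... | ξ , ξ∈ , ww with X⊆B ξ∈
      ... | i , i≤j , s = subst (_∈ targets₂ (a ∷ as)) (//-rightDividesˡ ξ (γ c))
              (∈-cartesianProductWith⁺ _⊕_ w∈ ξ∈)
        where
        lo hi : Fin n
        lo = argmin height a as
        hi = argmax height a as
        w∈ : γ c ⊖ ξ ∈ seen lo ++ seen hi
        w∈ with seen-by-extremes (all (argmin-∈ height a as)) (all c∈) (all (argmax-∈ height a as))
                  (argmin-≤ height a as c∈) (argmax-≥ height a as c∈)
                  (i , i≤j , sees-shift (//-rightDividesˡ ξ (γ c)) s)
        ... | inj₁ s = ∈-++⁺ˡ (∈-seen (proj₁ (all (argmin-∈ height a as))) ww s)
        ... | inj₂ s = ∈-++⁺ʳ (seen lo) (∈-seen (proj₁ (all (argmax-∈ height a as))) ww s)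

      targets : List (Fin n)
      targets = targets₁ alone ++ targets₂ crowded

      ∈-targets : ∀ {c} → InBlock c → γ c ∈ targets
      ∈-targets {c} (c∈ , cb∈) with HitsHole? c
      ... | no ¬hole = ∈-++⁺ˡ (∈-targets₁ alone
              (λ a∈ → let (p , q) = ∈-filter⁻ alone? {xs = members} a∈ in ∈-members p , q)
              (∈-filter⁺ alone? (∈-filter⁺ inBlock? c∈ cb∈) ¬hole))
      ... | yes hole = ∈-++⁺ʳ (targets₁ alone) (∈-targets₂ crowded
              (λ a∈ → ∈-members (proj₁ (∈-filter⁻ HitsHole? {xs = members} a∈)))
              (∈-filter⁺ HitsHole? (∈-filter⁺ inBlock? c∈ cb∈) hole) hole)

      length-near : ∀ c → length (near c) ≡ index * d
      length-near c = trans (length-cartesianProductWith _ elements (upTo d))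
        (cong (index *_) (List.length-upTo d))

      length-seen : ∀ c → length (seen c) ≡ suc holes
      length-seen c = cong suc (trans (List.length-map _ Xs) length-Xs)

      length-targets₁ : ∀ cs → length (targets₁ cs) ≤ index * d + index * d
      length-targets₁ []       = z≤n
      length-targets₁ (c ∷ cs) = ≤-reflexive (trans
        (List.length-++ (near (argmin height c cs)))
        (cong₂ _+_ (length-near (argmin height c cs)) (length-near (argmax height c cs))))

      length-targets₂ : ∀ cs → length (targets₂ cs) ≤ (suc holes + suc holes) * holes
      length-targets₂ []       = z≤n
      length-targets₂ (c ∷ cs) = ≤-reflexive (trans
        (length-cartesianProductWith _⊕_ (seen lo ++ seen hi) Xs)
        (cong₂ _*_ (trans (List.length-++ (seen lo))
          (cong₂ _+_ (length-seen lo) (length-seen hi))) length-Xs))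
        where
        lo hi : Fin n
        lo = argmin height c cs
        hi = argmax height c cs

    bound : ℕ
    bound = (index * d + index * d) + (suc holes + suc holes) * holes

    length-targets : ∀ b → length (Block.targets b) ≤ bound
    length-targets b = subst (_≤ bound) (sym (List.length-++ (targets₁ alone)))
      (+-mono-≤ (length-targets₁ alone) (length-targets₂ crowded))
      where open Block b

    -- The value `γ c` determines c, and then `γ c ⊖ β` determines β, so no pair in C × B is lost.
    code : Fin n × Fin n → Fin n × Fin n
    code (c , β) = γ c ⊖ β , γ c

    codes : List (Fin n × Fin n)
    codes = concatMap (λ b → map (b ,_) (Block.targets b)) (allFin n)

    length-codes : length codes ≤ n * bound
    length-codes = subst (λ z → length codes ≤ z * bound) (List.length-tabulate {n = n} id)
      (length-concatMap-≤ _ (λ b → subst (_≤ bound)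
        (sym (List.length-map (b ,_) (Block.targets b))) (length-targets b)) (allFin n))

    -- Pairs (c , β) are counted through the block b + B, b = γ c ⊖ β, in which γ c lies.
    C×B-bound : Unique Bs → length Cs * (index * suc j) ≤ n * bound
    C×B-bound uB = begin
      length Cs * (index * suc j)            ≡⟨ cong (length Cs *_) (sym length-Bs) ⟩
      length Cs * length Bs                  ≡⟨ sym (length-cartesianProductWith _,_ Cs Bs) ⟩
      length (cartesianProduct Cs Bs)        ≡⟨ sym (List.length-map code (cartesianProduct Cs Bs)) ⟩
      length (map code (cartesianProduct Cs Bs)) ≤⟨ length-mono-⊆ (unique-map code inj
        (Unique.cartesianProduct⁺ (Unique.filter⁺ (¬? ∘ (_∈? Xs)) uB) uB)) sub ⟩
      length codes                           ≤⟨ length-codes ⟩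
      n * bound                              ∎
      where
      open ≤-Reasoning
      inj : ∀ {p q} → p ∈ cartesianProduct Cs Bs → q ∈ cartesianProduct Cs Bs →
            code p ≡ code q → p ≡ q
      inj {c , β} {c′ , β′} p∈ q∈ eq
        with γ-injective (proj₁ (∈-cartesianProduct⁻ Cs Bs p∈)) (proj₁ (∈-cartesianProduct⁻ Cs Bs q∈))
               (cong proj₂ eq)
      ... | refl = cong (c ,_) (⊖-injectiveʳ (γ c) (cong proj₁ eq))
      sub : map code (cartesianProduct Cs Bs) ⊆ codes
      sub p∈ with ∈-map⁻ code p∈
      ... | (c , β) , q∈ , refl with ∈-cartesianProduct⁻ Cs Bs q∈
      ... | c∈ , β∈ = ∈-concatMap⁺ (λ b → map (b ,_) (Block.targets b))
              (lose (∈-allFin (γ c ⊖ β))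
                (∈-map⁺ _ (Block.∈-targets (γ c ⊖ β) (c∈ , subst (_∈ Bs) (sym (⊖-⊖ (γ c) β)) β∈))))

  -- Disjoint levels, and the inequality forced by minimality.

  -- This makes 0, x, ..., j x represent different cosets of H, so that B has |H| (j + 1) elements.
  Free : Set
  Free = ∀ {i} → 0 < i → i ≤ j → i · x ∉ elements

  -- If the levels differed, their difference times x would be `h ⊖ h′`, an element of H.
  at-injective-≤ : Free → ∀ {h i h′ i′} → h ∈ elements → h′ ∈ elements → i ≤ i′ → i′ ≤ j →
                   at (h , i) ≡ at (h′ , i′) → (h , i) ≡ (h′ , i′)
  at-injective-≤ free {h} {i} {h′} {i′} h∈ h′∈ i≤i′ i′≤j eq with m≤n⇒m<n∨m≡n i≤i′
  ... | inj₂ refl = cong (_, i) (∙-cancelʳ (i · x) h h′ eq)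
  ... | inj₁ i<i′ = contradiction (subst (_∈ elements) (sym δx≡) (⊖-closed h∈ h′∈))
                      (free (m<n⇒0<n∸m i<i′) (≤-trans (m∸n≤m i′ i) i′≤j))
    where
    open ≡-Reasoning
    δx≡ : (i′ ∸ i) · x ≡ h ⊖ h′
    δx≡ = ∙-cancelˡ h′ _ _ (∙-cancelʳ (i · x) _ _ (begin
      h′ ⊕ (i′ ∸ i) · x ⊕ i · x   ≡⟨ ⊕-assoc h′ _ _ ⟩
      h′ ⊕ ((i′ ∸ i) · x ⊕ i · x) ≡⟨ cong (h′ ⊕_) (sym (×-homo-+ x (i′ ∸ i) i)) ⟩
      h′ ⊕ (i′ ∸ i + i) · x       ≡⟨ cong (λ z → h′ ⊕ z · x) (m∸n+n≡m i≤i′) ⟩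
      h′ ⊕ i′ · x                 ≡⟨ sym eq ⟩
      h ⊕ i · x                   ≡⟨ cong (_⊕ i · x) (sym (⊖-⊕ h h′)) ⟩
      h′ ⊕ (h ⊖ h′) ⊕ i · x       ∎))

  unique-Bs : Free → Unique Bs
  unique-Bs free = unique-map at inj (Unique.cartesianProduct⁺ unique (Unique.upTo⁺ (suc j)))
    where
    inj : ∀ {p q} → p ∈ indices → q ∈ indices → at p ≡ at q → p ≡ q
    inj {h , i} {h′ , i′} p∈ q∈ eq
      with ∈-cartesianProduct⁻ elements (upTo (suc j)) p∈ | ∈-cartesianProduct⁻ elements (upTo (suc j)) q∈
    ... | h∈ , i∈ | h′∈ , i′∈ with ≤-total i i′
    ... | inj₁ i≤i′ = at-injective-≤ free h∈ h′∈ i≤i′ (≤-pred (∈-upTo⁻ i′∈)) eq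
    ... | inj₂ i′≤i = sym (at-injective-≤ free h′∈ h∈ i′≤i (≤-pred (∈-upTo⁻ i∈)) (sym eq))

  length-Cs-≥ : Free → index * suc j ≤ length Cs + holes
  length-Cs-≥ free = begin
    index * suc j          ≡⟨ sym length-Bs ⟩
    length Bs              ≤⟨ length-mono-⊆ (unique-Bs free) (λ a∈ →
                                [ ∈-++⁺ʳ Cs , ∈-++⁺ˡ ]′ (B⊆X∪C a∈)) ⟩
    length (Cs ++ Xs)      ≡⟨ List.length-++ Cs ⟩
    length Cs + length Xs  ≡⟨ cong (length Cs +_) length-Xs ⟩
    length Cs + holes      ∎
    where open ≤-Reasoning

  -- Minimality is applied to C without c: some point is then no longer covered, so each of its
  -- representations goes through c. This point is taken as γ c.
  minimal⇒bound : Free → MinimalComplement G (fromList Cs) →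
    length Cs * (index * suc j) ≤
      n * ((index * d + index * d) + (suc holes + suc holes) * holes)
  minimal⇒bound free (W , cov , minimal) =
    Counting.C×B-bound (_∈ₛ W) (Sub._∈? W) (proj₁ chosen) covers
      (λ c∈ a∈ wa → proj₂ chosen c∈ a∈ wa) (unique-Bs free)
    where
    covers : ∀ g → ∃ λ a → a ∈ Cs × g ⊖ a ∈ₛ W
    covers g with cov g
    ... | w , a , w∈ , a∈ , eq = a , ∈-fromList⁻ Cs a∈ , subst (_∈ₛ W) (sym (⊕⇒⊖ eq)) w∈

    isolate : ∀ {c} → c ∈ Cs → ∃ λ g → ∀ {a} → a ∈ Cs → g ⊖ a ∈ₛ W → a ≡ c
    -- Coverage is decidable at each of the n points, so its failure yields an explicit uncovered
    -- point.
    isolate {c} c∈ with Fin.¬∀⟶∃¬ n (λ g → Any (λ a → g ⊖ a ∈ₛ W) Ds)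
                          (λ g → Any.any? (λ a → (g ⊖ a) Sub.∈? W) Ds) ¬covers
      where
      Ds : List (Fin n)
      Ds = filter (¬? ∘ (Fin._≟ c)) Cs
      c∉Ds : c ∉ Ds
      c∉Ds p = proj₂ (∈-filter⁻ (¬? ∘ (Fin._≟ c)) {xs = Cs} p) refl
      Ds⊂Cs : fromList Ds ⊂ fromList Cs
      Ds⊂Cs = (λ p → ∈-fromList⁺ (proj₁ (∈-filter⁻ (¬? ∘ (Fin._≟ c)) {xs = Cs} (∈-fromList⁻ Ds p))))
            , c , ∈-fromList⁺ c∈ , c∉Ds ∘ ∈-fromList⁻ Ds
      ¬covers : ¬ (∀ g → Any (λ a → g ⊖ a ∈ₛ W) Ds)
      ¬covers all = minimal (fromList Ds) Ds⊂Cs λ g →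
        let (a , a∈ , wa) = find (all g) in g ⊖ a , a , wa , ∈-fromList⁺ a∈ , //-rightDividesˡ a g
    ... | g , ¬any = g , λ {a} a∈ wa → case a∈ wa (a Fin.≟ c)
      where
      case : ∀ {a} → a ∈ Cs → g ⊖ a ∈ₛ W → Dec (a ≡ c) → a ≡ c
      case a∈ wa (yes p) = p
      case a∈ wa (no ¬p) = contradiction (lose (∈-filter⁺ (¬? ∘ (Fin._≟ c)) a∈ ¬p) wa) ¬any

    chosen : ∃ λ γ → ∀ {c} → c ∈ Cs → ∀ {a} → a ∈ Cs → γ c ⊖ a ∈ₛ W → a ≡ c
    chosen = choice Cs 𝟘 isolate

  -- Adjoining one generator to a subgroup.

  -- Here `suc j` is the order of x modulo H, so B is the subgroup generated by H and x.
  extension : Free → suc j · x ∈ elements → Subgroup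
  extension free Mx∈ = record
    { elements = Bs
    ; unique   = unique-Bs free
    ; 𝟘∈       = subst (_∈ Bs) (⊕-identityˡ 𝟘) (at∈B 𝟘∈ z≤n)
    ; ⊕-closed = add
    ; ⊝-closed = neg
    }
    where
    open ≡-Reasoning
    add : ∀ {a b} → a ∈ Bs → b ∈ Bs → a ⊕ b ∈ Bs
    add a∈ b∈ with ∈B⇒at a∈ | ∈B⇒at b∈
    ... | h , i , h∈ , i≤j , refl | h′ , i′ , h′∈ , i′≤j , refl
      with i + i′ ≤? j | solve 4 (λ h i h′ i′ → (h :+ i) :+ (h′ :+ i′) ⊜ (h :+ h′) :+ (i :+ i′))
                           refl h (i · x) h′ (i′ · x)
    ... | yes p | eq = subst (_∈ Bs) (sym (trans eq (cong (h ⊕ h′ ⊕_) (sym (×-homo-+ x i i′)))))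
                         (at∈B (⊕-closed h∈ h′∈) p)
    -- When the levels add up to more than j, `suc j · x` is carried into H.
    ... | no ¬p | eq = subst (_∈ Bs) (sym (begin
            h ⊕ i · x ⊕ (h′ ⊕ i′ · x)        ≡⟨ eq ⟩
            h ⊕ h′ ⊕ (i · x ⊕ i′ · x)        ≡⟨ cong (h ⊕ h′ ⊕_) (sym (×-homo-+ x i i′)) ⟩
            h ⊕ h′ ⊕ (i + i′) · x            ≡⟨ cong (λ z → h ⊕ h′ ⊕ z · x) (sym k≡) ⟩
            h ⊕ h′ ⊕ (suc j + k) · x         ≡⟨ cong (h ⊕ h′ ⊕_) (×-homo-+ x (suc j) k) ⟩
            h ⊕ h′ ⊕ (suc j · x ⊕ k · x)     ≡⟨ sym (⊕-assoc (h ⊕ h′) _ _) ⟩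
            h ⊕ h′ ⊕ suc j · x ⊕ k · x       ∎))
            (at∈B (⊕-closed (⊕-closed h∈ h′∈) Mx∈) k≤j)
      where
      k : ℕ
      k = i + i′ ∸ suc j
      k≡ : suc j + k ≡ i + i′
      k≡ = m+[n∸m]≡n (≰⇒> ¬p)
      k≤j : k ≤ j
      k≤j = ≤-trans (∸-mono (+-mono-≤ i≤j i′≤j) (n≤1+n j)) (≤-reflexive (m+n∸n≡m j j))

    neg : ∀ {a} → a ∈ Bs → ⊝ a ∈ Bs
    neg a∈ with ∈B⇒at a∈
    -- Level 0 is its own opposite; the formula for the other levels would give `suc j`, which is
    -- too high.
    ... | h , zero , h∈ , _ , refl = subst (_∈ Bs)
            (trans (⊕-identityʳ (⊝ h)) (cong ⊝_ (sym (⊕-identityʳ h)))) (at∈B (⊝-closed h∈) z≤n)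
    -- The opposite level is `suc j` minus `suc i`, and the surplus `suc j · x` is again absorbed by
    -- H.
    ... | h , suc i , h∈ , i<j , refl = subst (_∈ Bs) (inverseʳ-unique _ _ (begin
            h ⊕ suc i · x ⊕ (⊝ (h ⊕ suc j · x) ⊕ (j ∸ i) · x)
              ≡⟨ solve 4 (λ h i m k → (h :+ i) :+ (m :+ k) ⊜ (h :+ (i :+ k)) :+ m)
                   refl h (suc i · x) (⊝ (h ⊕ suc j · x)) ((j ∸ i) · x) ⟩
            h ⊕ (suc i · x ⊕ (j ∸ i) · x) ⊕ ⊝ (h ⊕ suc j · x)
              ≡⟨ cong (λ z → h ⊕ z ⊖ (h ⊕ suc j · x)) (sym (×-homo-+ x (suc i) (j ∸ i))) ⟩
            h ⊕ (suc i + (j ∸ i)) · x ⊖ (h ⊕ suc j · x)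
              ≡⟨ cong (λ z → h ⊕ suc z · x ⊖ (h ⊕ suc j · x)) (m+[n∸m]≡n (<⇒≤ i<j)) ⟩
            (h ⊕ suc j · x) ⊖ (h ⊕ suc j · x)
              ≡⟨ ⊝-inverseʳ _ ⟩
            𝟘 ∎))
            (at∈B (⊝-closed (⊕-closed h∈ Mx∈)) (m∸n≤m j i))

-- Growing subgroups under the assumption that T is large.

module Growth {n : ℕ} (G : FinAbGroup n) {t : ℕ} (good : GoodT G t) where

  open GroupLemmas G
  open Subgroup using (elements; 𝟘∈)
  open DecMembership (Fin._≟_ {n}) using (_∈?_)

  ∣_∣ˢ : Subgroup → ℕ
  ∣ S ∣ˢ = length (elements S)

  trivial : Subgroup
  trivial = record
    { elements = 𝟘 ∷ []
    ; unique   = All.[] ∷ []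
    ; 𝟘∈       = here refl
    ; ⊕-closed = λ { (here refl) (here refl) → here (⊕-identityˡ 𝟘) }
    ; ⊝-closed = λ { (here refl) → here (trans (sym (⊕-identityˡ _)) (⊝-inverseʳ 𝟘)) }
    }

  module _ (S : Subgroup) (x : Fin n) (j d : ℕ) where

    open Progression G S x j d

    private
      L : ℕ
      L = ∣ S ∣ˢ * suc j

    -- The size of C is known only up to the number of holes, so the numerical contradiction is
    -- asked for every m in place of |C|.
    too-large : Free → L ≤ t →
      ¬ (∀ m → L ≤ m + holes →
         n * ((index * d + index * d) + (suc holes + suc holes) * holes) < m * L)
    too-large free L≤t count = <⇒≱ (count (length Cs) (length-Cs-≥ free))
      (minimal⇒bound free (proj₂ good (fromList Cs) nonempty
        (≤-trans (∣fromList∣≤length Cs) (≤-trans length-Cs-≤ L≤t))))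
      where
      nonempty : Nonempty (fromList Cs)
      -- An empty C would give m = 0, for which the strict inequality fails.
      nonempty with Cs | count (length Cs) (length-Cs-≥ free)
      ... | []     | ()
      ... | c ∷ cs | _ = c , ∈-fromList⁺ {xs = c ∷ cs} (here refl)

  module _ (r : ℕ) (0<r : 0 < r) (n≤r⁴ : n ≤ r * r * (r * r)) (8r³<t : 8 * (r * (r * r)) < t) where

    open ≤-Reasoning

    private
      r² r³ : ℕ
      r² = r * r
      r³ = r * (r * r)

      instance
        r≢0 : NonZero r
        r≢0 = >-nonZero 0<r

      r²≤r³ : r² ≤ r³
      r²≤r³ = m≤n*m r² r

      r≤r² : r ≤ r²
      r≤r² = m≤n*m r r

      0<r³ : 0 < r³
      0<r³ = ≤-trans 0<r (≤-trans r≤r² r²≤r³)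

    -- With one level and D = 1 the only hole is 0 and the bound per translate is 4. A larger H
    -- would give (|H| - 1) |H| > 4 r⁴ ≥ 4 n.
    ∣S∣≤2r² : ∀ (S : Subgroup) → ∣ S ∣ˢ ≤ t → ∣ S ∣ˢ ≤ 2 * r²
    ∣S∣≤2r² S h≤t with ∣ S ∣ˢ ≤? 2 * r²
    ... | yes p = p
    ... | no ¬p = ⊥-elim (too-large S 𝟘 0 0 (λ { (s≤s z≤n) () })
                    (≤-trans (≤-reflexive (*-identityʳ h)) h≤t) count)
      where
      h : ℕ
      h = ∣ S ∣ˢ
      count : ∀ m → h * 1 ≤ m + 1 → n * ((h * 0 + h * 0) + 4) < m * (h * 1)
      count m le = begin-strict
        n * ((h * 0 + h * 0) + 4)       ≡⟨ cong (λ z → n * ((z + z) + 4)) (*-zeroʳ h) ⟩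
        n * 4                           ≤⟨ *-monoˡ-≤ 4 n≤r⁴ ⟩
        r² * r² * 4                     ≡⟨ ring₁ r² ⟩
        2 * r² * (2 * r²)               <⟨ *-monoʳ-< (2 * r²) {{2r²≢0}} (n<1+n (2 * r²)) ⟩
        2 * r² * suc (2 * r²)           ≤⟨ *-mono-≤ 2r²≤m (≰⇒> ¬p) ⟩
        m * h                           ≡⟨ cong (m *_) (sym (*-identityʳ h)) ⟩
        m * (h * 1)                     ∎
        where
        ring₁ : ∀ a → a * a * 4 ≡ 2 * a * (2 * a)
        ring₁ = solve-∀
        2r²≢0 : NonZero (2 * r²)
        2r²≢0 = >-nonZero (≤-trans 0<r (≤-trans r≤r² (m≤n*m r² 2)))
        2r²≤m : 2 * r² ≤ m
        2r²≤m = ≤-pred (≤-trans (≰⇒> ¬p) (≤-trans (≤-reflexive (sym (*-identityʳ h)))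
                  (≤-trans le (≤-reflexive (+-comm m 1)))))

    -- The two kinds of targets number at most 8 r² and 6 r · 2 r per translate, 20 r⁶ in all, while
    -- |C| |B| ≥ 4 r³ · 6 r³.
    long-progression : ∀ (S : Subgroup) x j → Progression.Free G S x j 0 → ∣ S ∣ˢ ≤ 2 * r² →
      6 * r³ ≤ ∣ S ∣ˢ * suc j → ¬ ∣ S ∣ˢ * suc j ≤ 8 * r³
    long-progression S x j free h≤2r² lower upper =
      too-large S x j d free (≤-trans upper (<⇒≤ 8r³<t)) count
      where
      h : ℕ
      h = ∣ S ∣ˢ
      instance
        h≢0 : NonZero h
        h≢0 = >-nonZero (∈-length (𝟘∈ S))
      d D k holes : ℕ
      -- The largest spacing with h d ≤ 4 r²; then h D ≥ 4 r² keeps the number of holes at most 2 r.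
      d = 4 * r² / h
      D = suc d
      k = j / D
      holes = suc k
      hd≤4r² : h * d ≤ 4 * r²
      hd≤4r² = ≤-trans (≤-reflexive (*-comm h d)) (m/n*n≤m (4 * r²) h)
      4r²≤hD : 4 * r² ≤ h * D
      4r²≤hD = begin
        4 * r²                    ≡⟨ m≡m%n+[m/n]*n (4 * r²) h ⟩
        4 * r² % h + d * h        ≤⟨ +-monoˡ-≤ (d * h) (<⇒≤ (m%n<n (4 * r²) h)) ⟩
        D * h                     ≡⟨ *-comm D h ⟩
        h * D                     ∎
      k<2r : k < 2 * r
      k<2r = *-cancelʳ-< (4 * r²) k (2 * r) (begin-strict
        k * (4 * r²)     ≤⟨ *-monoʳ-≤ k 4r²≤hD ⟩
        k * (h * D)      ≡⟨ ring k h D ⟩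
        h * (k * D)      ≤⟨ *-monoʳ-≤ h (m/n*n≤m j D) ⟩
        h * j            <⟨ *-monoʳ-< h (n<1+n j) ⟩
        h * suc j        ≤⟨ upper ⟩
        8 * r³           ≡⟨ ring′ r ⟩
        2 * r * (4 * r²) ∎)
        where
        ring : ∀ k h D → k * (h * D) ≡ h * (k * D)
        ring = solve-∀
        ring′ : ∀ r → 8 * (r * (r * r)) ≡ 2 * r * (4 * (r * r))
        ring′ = solve-∀
      count : ∀ m → h * suc j ≤ m + holes →
        n * ((h * d + h * d) + (suc holes + suc holes) * holes) < m * (h * suc j)
      count m le = begin-strict
        n * ((h * d + h * d) + (suc holes + suc holes) * holes)
          ≤⟨ *-mono-≤ n≤r⁴ (+-mono-≤ (+-mono-≤ hd≤4r² hd≤4r²)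
               (*-mono-≤ (+-mono-≤ holes≤3r holes≤3r) k<2r)) ⟩
        r² * r² * ((4 * r² + 4 * r²) + (3 * r + 3 * r) * (2 * r))
          ≡⟨ ring₁ r ⟩
        20 * (r³ * r³)
          <⟨ *-monoˡ-< (r³ * r³) {{r⁶≢0}} {20} {24} (<ᵇ⇒< 20 24 _) ⟩
        24 * (r³ * r³)
          ≡⟨ ring₂ r³ ⟩
        4 * r³ * (6 * r³)
          ≤⟨ *-mono-≤ 4r³≤m lower ⟩
        m * (h * suc j) ∎
        where
        ring₁ : ∀ r → r * r * (r * r) * ((4 * (r * r) + 4 * (r * r)) + (3 * r + 3 * r) * (2 * r))
                    ≡ 20 * (r * (r * r) * (r * (r * r)))
        ring₁ = solve-∀
        ring₂ : ∀ a → 24 * (a * a) ≡ 4 * a * (6 * a)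
        ring₂ = solve-∀
        ring₃ : ∀ a → 4 * a + 2 * a ≡ 6 * a
        ring₃ = solve-∀
        r⁶≢0 : NonZero (r³ * r³)
        r⁶≢0 = >-nonZero (*-mono-≤ 0<r³ 0<r³)
        holes≤3r : suc holes ≤ 3 * r
        holes≤3r = +-mono-≤ 0<r k<2r
        4r³≤m : 4 * r³ ≤ m
        4r³≤m = +-cancelʳ-≤ (2 * r³) (4 * r³) m (begin
          4 * r³ + 2 * r³  ≡⟨ ring₃ r³ ⟩
          6 * r³           ≤⟨ lower ⟩
          h * suc j        ≤⟨ le ⟩
          m + holes        ≤⟨ +-monoʳ-≤ m k<2r ⟩
          m + 2 * r        ≤⟨ +-monoʳ-≤ m (*-monoʳ-≤ 2 (≤-trans r≤r² r²≤r³)) ⟩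
          m + 2 * r³       ∎)

    Larger : Subgroup → Set
    Larger S = ∃ λ S′ → ∣ S ∣ˢ < ∣ S′ ∣ˢ × ∣ S′ ∣ˢ ≤ t

    -- Levels are added one by one until B closes up to a subgroup or reaches size 6 r³. As each
    -- level adds at most 2 r², the second event happens below 8 r³, where `long-progression` rules
    -- it out. The fuel `f` bounds the levels still to be tried.
    enlarge : ∀ (S : Subgroup) {x} → x ∉ elements S → ∣ S ∣ˢ ≤ 2 * r² →
      ∀ f j → Progression.Free G S x j 0 → ∣ S ∣ˢ * j ≤ 6 * r³ → 6 * r³ ≤ j + f → Larger S
    enlarge S {x} x∉ h≤ f j free hj≤ fuel with 6 * r³ ≤? ∣ S ∣ˢ * suc j
    ... | yes long = ⊥-elim (long-progression S x j free h≤ long (begin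
            ∣ S ∣ˢ * suc j          ≡⟨ *-suc ∣ S ∣ˢ j ⟩
            ∣ S ∣ˢ + ∣ S ∣ˢ * j     ≤⟨ +-mono-≤ (≤-trans h≤ (*-monoʳ-≤ 2 r²≤r³)) hj≤ ⟩
            2 * r³ + 6 * r³         ≡⟨ ring r³ ⟩
            8 * r³                  ∎))
      where
      ring : ∀ a → 2 * a + 6 * a ≡ 8 * a
      ring = solve-∀
    ... | no short with (suc j · x) ∈? elements S
    enlarge S {x} x∉ h≤ f zero free hj≤ fuel | no short | yes x∈ =
      contradiction (subst (_∈ elements S) (⊕-identityʳ x) x∈) x∉
    enlarge S {x} x∉ h≤ f j@(suc _) free hj≤ fuel | no short | yes x∈ =
      Progression.extension G S x j 0 free x∈ ,
      subst (∣ S ∣ˢ <_) (sym (Progression.length-Bs G S x j 0))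
        (m<m*n ∣ S ∣ˢ (suc j) {{h≢0}} (s≤s (s≤s z≤n))) ,
      (begin
        length (Progression.Bs G S x j 0) ≡⟨ Progression.length-Bs G S x j 0 ⟩
        ∣ S ∣ˢ * suc j           ≤⟨ <⇒≤ (≰⇒> short) ⟩
        6 * r³                   ≤⟨ *-monoˡ-≤ r³ {6} {8} (≤ᵇ⇒≤ 6 8 _) ⟩
        8 * r³                   ≤⟨ <⇒≤ 8r³<t ⟩
        t                        ∎)
      where
      h≢0 : NonZero ∣ S ∣ˢ
      h≢0 = >-nonZero (∈-length (𝟘∈ S))
    -- Without fuel j is at least 6 r³, so B was already long.
    enlarge S x∉ h≤ zero j free hj≤ fuel | no short | no _ =
      contradiction (begin
        6 * r³          ≤⟨ fuel ⟩
        j + 0           ≡⟨ +-identityʳ j ⟩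
        j               ≤⟨ n≤1+n j ⟩
        suc j           ≤⟨ m≤n*m (suc j) ∣ S ∣ˢ {{>-nonZero (∈-length (𝟘∈ S))}} ⟩
        ∣ S ∣ˢ * suc j  ∎) short
    enlarge S {x} x∉ h≤ (suc f) j free hj≤ fuel | no short | no jx∉ =
      enlarge S x∉ h≤ f (suc j) free′ (<⇒≤ (≰⇒> short)) (subst (6 * r³ ≤_) (+-suc j f) fuel)
      where
      free′ : Progression.Free G S x (suc j) 0
      free′ 0<i i≤1+j with m≤n⇒m<n∨m≡n i≤1+j
      ... | inj₁ i<1+j = free 0<i (≤-pred i<1+j)
      ... | inj₂ refl  = jx∉

    -- A subgroup of order at most 2 r² < n misses some x and can be enlarged within size t, hence
    -- again to order at most 2 r². Orders cannot increase like this for 2 r² steps from the trivial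
    -- subgroup.
    n≤2r² : ¬ 2 * r² < n
    n≤2r² 2r²<n = climb (2 * r²) trivial (≤-trans 0<r (≤-trans r≤r² (m≤n*m r² 2)))
                    (n<1+n (2 * r²))
      where
      climb : ∀ f (S : Subgroup) → ∣ S ∣ˢ ≤ 2 * r² → ¬ 2 * r² < ∣ S ∣ˢ + f
      climb zero    S h≤ lt = <⇒≱ lt (≤-trans (≤-reflexive (+-identityʳ ∣ S ∣ˢ)) h≤)
      climb (suc f) S h≤ lt
        with Fin.¬∀⟶∃¬ n (_∈ elements S) (_∈? elements S) ¬all
        where
        ¬all : ¬ (∀ x → x ∈ elements S)
        ¬all all = <⇒≱ 2r²<n (begin
          n                  ≡⟨ sym (List.length-tabulate {n = n} id) ⟩
          length (allFin n)  ≤⟨ length-mono-⊆ (Unique.allFin⁺ n) (λ {x} _ → all x) ⟩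
          ∣ S ∣ˢ             ≤⟨ h≤ ⟩
          2 * r²             ∎)
      ... | x , x∉ with enlarge S x∉ h≤ (6 * r³) 0 (λ { (s≤s z≤n) () })
                          (≤-trans (≤-reflexive (*-zeroʳ ∣ S ∣ˢ)) z≤n) ≤-refl
      ... | S′ , bigger , S′≤t = climb f S′ (∣S∣≤2r² S′ S′≤t)
              (≤-trans lt (≤-trans (≤-reflexive (+-suc ∣ S ∣ˢ f)) (+-monoˡ-≤ f bigger)))

    absurd : ⊥
    absurd = n≤2r² (begin-strict
      2 * r²   ≤⟨ *-mono-≤ {2} {8} (≤ᵇ⇒≤ 2 8 _) r²≤r³ ⟩
      8 * r³   <⟨ 8r³<t ⟩
      t        ≤⟨ proj₁ good ⟩
      n        ∎)

-- Integer fourth roots and the final exponents.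

^-distribʳ-* : ∀ k m n → (m * n) ^ k ≡ m ^ k * n ^ k
^-distribʳ-* zero    m n = refl
^-distribʳ-* (suc k) m n =
  trans (cong (m * n *_) (^-distribʳ-* k m n)) (interchange m n (m ^ k) (n ^ k))
  where
  interchange : ∀ a b c d → a * b * (c * d) ≡ a * c * (b * d)
  interchange = solve-∀

-- When r⁴ becomes too small, r + 1 ≤ 2 r takes over; this doubling costs the factor 16.
fourth-root : ∀ n → ∃ λ r → suc n ≤ r ^ 4 × r ^ 4 ≤ 16 * suc n × 0 < r
fourth-root zero    = 1 , ≤-refl , s≤s z≤n , s≤s z≤n
fourth-root (suc n) with fourth-root n
... | r , lo , hi , 0<r with suc (suc n) ≤? r ^ 4
... | yes p = r , p , ≤-trans hi (*-monoʳ-≤ 16 (n≤1+n (suc n))) , 0<r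
... | no ¬p = suc r , ≤-trans (s≤s lo) (^-monoˡ-< 4 (n<1+n r)) , (begin
        suc r ^ 4        ≤⟨ ^-monoˡ-≤ 4 (+-mono-≤ 0<r (≤-reflexive (sym (+-identityʳ r)))) ⟩
        (2 * r) ^ 4      ≡⟨ ^-distribʳ-* 4 2 r ⟩
        16 * r ^ 4       ≤⟨ *-monoʳ-≤ 16 (<⇒≤ (≰⇒> ¬p)) ⟩
        16 * suc (suc n) ∎) , s≤s z≤n
  where open ≤-Reasoning

fourth-power-≤ : ∀ a b K r t N → a ^ 4 * b ^ 3 ≡ K ^ 4 → t ≤ a * r ^ 3 → r ^ 4 ≤ b * N →
                 t ^ 4 ≤ K ^ 4 * N ^ 3
fourth-power-≤ a b K r t N eq t≤ r⁴≤ = begin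
  t ^ 4                      ≤⟨ ^-monoˡ-≤ 4 t≤ ⟩
  (a * r ^ 3) ^ 4            ≡⟨ ^-distribʳ-* 4 a (r ^ 3) ⟩
  a ^ 4 * (r ^ 3) ^ 4        ≡⟨ cong (a ^ 4 *_) (trans (^-*-assoc r 3 4) (sym (^-*-assoc r 4 3))) ⟩
  a ^ 4 * (r ^ 4) ^ 3        ≤⟨ *-monoʳ-≤ (a ^ 4) (^-monoˡ-≤ 3 r⁴≤) ⟩
  a ^ 4 * (b * N) ^ 3        ≡⟨ cong (a ^ 4 *_) (^-distribʳ-* 3 b N) ⟩
  a ^ 4 * (b ^ 3 * N ^ 3)    ≡⟨ sym (*-assoc (a ^ 4) (b ^ 3) (N ^ 3)) ⟩
  a ^ 4 * b ^ 3 * N ^ 3      ≡⟨ cong (_* N ^ 3) eq ⟩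
  K ^ 4 * N ^ 3              ∎
  where open ≤-Reasoning

T-bound : ∀ {n} (G : FinAbGroup n) {t} → GoodT G t → t ^ 4 ≤ 64 ^ 4 * n ^ 3
T-bound {zero}  G good = contradiction (FinAbGroup.0# G) Fin.¬Fin0
-- The constant is 64 because 8⁴ · 16³ = 2²⁴ = 64⁴.
T-bound {suc n} G {t} good = fourth-power-≤ 8 16 64 r t (suc n) refl t≤8r³
  (proj₁ (proj₂ (proj₂ root)))
  where
  root : ∃ λ r → suc n ≤ r ^ 4 × r ^ 4 ≤ 16 * suc n × 0 < r
  root = fourth-root n
  r : ℕ
  r = proj₁ root
  cube : ∀ r → r * (r * r) ≡ r * (r * (r * 1))
  cube = solve-∀
  fourth : ∀ r → r * (r * (r * (r * 1))) ≡ r * r * (r * r)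
  fourth = solve-∀
  t≤8r³ : t ≤ 8 * r ^ 3
  t≤8r³ = subst (λ z → t ≤ 8 * z) (cube r)
    (≮⇒≥ (Growth.absurd G good r (proj₂ (proj₂ (proj₂ root)))
      (subst (suc n ≤_) (fourth r) (proj₁ (proj₂ root)))))

-- Here ε = p / q, and the inequality is raised to the power 4 q to stay within the natural numbers.
-- The same constant 64 serves every ε.
theorem1p3 : ∀ (p q : ℕ) → NonZero p → NonZero q →
    Σ ℕ λ K → (NonZero K ×
    (∀ (n : ℕ) (G : FinAbGroup n) (t : ℕ) → IsT G t →
    t ^ (4 * q) ≤ K ^ (4 * q) * n ^ (3 * q + 4 * p)))
theorem1p3 p q _ _ = 64 , _ , bound
  where
  open ≤-Reasoning
  bound : ∀ n (G : FinAbGroup n) t → IsT G t →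
          t ^ (4 * q) ≤ 64 ^ (4 * q) * n ^ (3 * q + 4 * p)
  -- A group has an element, so n = 0 is impossible; afterwards n ≥ 1 makes its powers grow with the
  -- exponent.
  bound zero      G t _          = contradiction (FinAbGroup.0# G) Fin.¬Fin0
  bound n@(suc _) G t (good , _) = begin
    t ^ (4 * q)                         ≡⟨ sym (^-*-assoc t 4 q) ⟩
    (t ^ 4) ^ q                         ≤⟨ ^-monoˡ-≤ q (T-bound G good) ⟩
    (64 ^ 4 * n ^ 3) ^ q                ≡⟨ ^-distribʳ-* q (64 ^ 4) (n ^ 3) ⟩
    (64 ^ 4) ^ q * (n ^ 3) ^ q          ≡⟨ cong₂ _*_ (^-*-assoc 64 4 q) (^-*-assoc n 3 q) ⟩
    64 ^ (4 * q) * n ^ (3 * q)          ≤⟨ *-monoʳ-≤ (64 ^ (4 * q))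
                                             (^-monoʳ-≤ n (m≤m+n (3 * q) (4 * p))) ⟩
    64 ^ (4 * q) * n ^ (3 * q + 4 * p)  ∎
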